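{- Let $P$ be a DB protocol. Then, for any $n$, for any $D\le n/6$, and for any $\Delta\le n/D$, there exists an $n$-node directed graph $G^P$ of maximum eccentricity $D$ and in-degree bounded by $\Delta$ such that $P$ completes broadcasting on $G^P$ in $\Omega(D\Delta\log(n/\Delta))$ time-slots (that is, it needs at least that many). The lower bound holds even when every node knows $n$ and $\Delta$.
   Context: A (radio) network is a directed graph whose nodes have distinct labels; an edge $(u,v)$ means $u$ can transmit to $v$ in one hop. One specified node, the source, initially holds the source message. A deterministic distributed broadcast (DB) protocol works in time-slots $0,1,2,\dots$ as follows. (1) In the initial time-slot the source transmits the source message. (2) In each time-slot each node acts as a transmitter (sending a message, of arbitrary size, along all its outgoing edges), or as a receiver, or is non active. (3) A node receives a message in a time-slot if and only if it acts as a receiver and exactly one of its in-neighbours acts as a transmitter in that slot; nodes cannot distinguish a collision from silence. (4) The action of a node in a time-slot is a function of its own label, the number of the current slot, and the messages it received in previous slots; nodes know nothing else about the network beyond what is explicitly stated. Nodes may transmit before having received any message. The protocol has completed broadcasting when all nodes reachable from the source have received the source message. The eccentricity of a source node $s$ is the largest (directed) distance from $s$ to a node reachable from it; the maximum eccentricity $D$ is the maximum over all possible source nodes.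
   Formalization: The formal theorem assumes D ≥ 2 and Δ ≥ 2: for D = 1 broadcasting can finish in one slot, and for Δ = 1 no collisions occur and D slots suffice, so the stated bound fails there; D = 0 or Δ = 0 makes n/D or n/Δ undefined. -}

module Defs where

open import Data.Bool using (Bool; true; false; T)
open import Data.Fin using (Fin; toℕ; _≟_)
open import Data.List using (List; []; _∷_; length; filterᵇ; map; mapMaybe; allFin)
open import Data.Maybe using (Maybe; just; nothing)
import Data.Maybe.Relation.Unary.Any as Maybe
open import Data.Nat using (ℕ; zero; suc; _*_; _^_; _≤_)
open import Data.Product using (_×_; ∃-syntax)
open import Data.Sum using (_⊎_)
open import Data.Vec using (Vec; []; _∷_)
open import Data.Vec.Relation.Unary.Any using (Any)
open import Function using (_∘_)
open import Relation.Binary.PropositionalEquality using (_≡_)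
open import Relation.Nullary.Decidable using (⌊_⌋)

-- A network with n nodes; the label of the node v is the number toℕ v < n.
record Digraph (n : ℕ) : Set where
  field
    edge     : Fin n → Fin n → Bool
    loopless : ∀ v → edge v v ≡ false

  inNeighbours : Fin n → List (Fin n)
  inNeighbours v = filterᵇ (λ u → edge u v) (allFin n)

  inDegree : Fin n → ℕ
  inDegree v = length (inNeighbours v)

module _ {n : ℕ} (G : Digraph n) where
  open Digraph G

  data Walk (u : Fin n) : Fin n → ℕ → Set where
    []   : Walk u u 0
    _∷ʳ_ : ∀ {v w k} → Walk u v k → T (edge v w) → Walk u w (suc k)

  Reachable : Fin n → Fin n → Set
  Reachable u v = ∃[ k ] Walk u v k

  IsDistance : Fin n → Fin n → ℕ → Set
  IsDistance u v d = Walk u v d × (∀ k → Walk u v k → d ≤ k)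

  IsEccentricity : Fin n → ℕ → Set
  IsEccentricity s e =
    (∃[ v ] IsDistance s v e) × (∀ v d → IsDistance s v d → d ≤ e)

  IsMaxEccentricity : ℕ → Set
  IsMaxEccentricity D =
    (∃[ s ] IsEccentricity s D) × (∀ s e → IsEccentricity s e → e ≤ D)

data Action (M : Set) : Set where
  transmit : M → Action M
  receive  : Action M
  inactive : Action M

-- What a node received in the slots t - 1, …, 1, 0, in this order; a slot
-- without reception (silence, collision, or not listening) is `nothing`.
History : Set → ℕ → Set
History M t = Vec (Maybe M) t

-- Messages are arbitrary; `carries m` says whether the source message is part
-- of m.  The Bool argument of `action` says whether the node is the source,
-- which initially holds the source message; the first ℕ is the node's label and
-- the second the number of the current slot.
record Protocol : Set₁ where
  field
    Msg     : Set
    carries : Msg → Bool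
    action  : Bool → ℕ → (t : ℕ) → History Msg t → Action Msg

  Holds : ∀ {t} → Bool → History Msg t → Set
  Holds isSource h = T isSource ⊎ Any (Maybe.Any (T ∘ carries)) h

  field
    source-starts : ∀ ℓ → ∃[ m ] (action true ℓ 0 [] ≡ transmit m × T (carries m))
    -- The source message can be passed on only by nodes that hold it.
    -- Otherwise nodes may transmit freely, also before any reception.
    no-forgery    : ∀ isSource ℓ t (h : History Msg t) m →
                    action isSource ℓ t h ≡ transmit m →
                    T (carries m) → Holds isSource h

module _ {M : Set} where

  transmission : Action M → Maybe M
  transmission (transmit m) = just m
  transmission receive      = nothing
  transmission inactive     = nothing

  onlyElement : List M → Maybe M
  onlyElement []          = nothing
  onlyElement (m ∷ [])    = just m
  onlyElement (_ ∷ _ ∷ _) = nothing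

  -- What a node acting as in the first argument receives when its
  -- in-neighbours act as in the second.
  reception : Action M → List (Action M) → Maybe M
  reception receive      as = onlyElement (mapMaybe transmission as)
  reception (transmit _) as = nothing
  reception inactive     as = nothing

module Execution (P : Protocol) {n : ℕ} (G : Digraph n) (s : Fin n) where
  open Protocol P
  open Digraph G

  isSource : Fin n → Bool
  isSource v = ⌊ v ≟ s ⌋

  actionAt : (t : ℕ) → (Fin n → History Msg t) → Fin n → Action Msg
  actionAt t h v = action (isSource v) (toℕ v) t (h v)

  history : (t : ℕ) → Fin n → History Msg t
  history zero    v = []
  history (suc t) v =
    reception (act v) (map act (inNeighbours v)) ∷ history t v
    where act = actionAt t (history t)

-- Broadcasting from s is complete after the t slots 0, …, t - 1.
CompletesWithin : Protocol → ∀ {n} → Digraph n → Fin n → ℕ → Set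
CompletesWithin P G s t =
  ∀ v → Reachable G s v → Holds (isSource v) (history t v)
  where
    open Protocol P
    open Execution P G s

-- The real inequality a · log₂ (p / q) ≤ b, for p, q ≥ 1, exponentiated and
-- cleared of denominators, so that nothing is rounded.
infix 4 _·log₂[_/_]≤_
_·log₂[_/_]≤_ : ℕ → ℕ → ℕ → ℕ → Set
a ·log₂[ p / q ]≤ b = p ^ a ≤ 2 ^ b * q ^ a

{-# OPTIONS --safe #-}

-- In a layered network whose consecutive layers are completely joined, the
-- behaviour of a node in layer j depends only on the layers before it, so an
-- adversary can fix the layers one after the other.  Against the next τ slots
-- he chooses layer j inside the set of unused labels as a nonempty set X of at
-- most 2 h ≤ Δ nodes such that in each of these slots an even number of nodes of
-- X transmit; then nothing gets from layer j to layer j + 1 during these slots,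
-- and every layer delays the source message by τ slots.  Such an X exists by
-- counting: the symmetric difference of two of the q ^ h > 2 ^ τ transversals of
-- h disjoint blocks of q unused labels, namely two whose intersections with the
-- τ sets of transmitters have the same parities.  Since at least n / 2 labels
-- remain unused, q can be about n / 2 h, and τ is of order Δ log (n / Δ).
module Submission where

open import Defs
open import Data.Bool using (Bool; true; false; T; if_then_else_; not; _∧_; _xor_)
open import Data.Bool.Properties
  using (T-≡; ¬-not; ∧-zeroʳ; T?; ∧-distribʳ-xor; xor-same; not-distribˡ-xor;
    not-distribʳ-xor; not-involutive)
open import Data.Fin as Fin
  using (fromℕ<; Fin; zero; suc; toℕ; combine; funToFin; finToFun; inject≤; _≟_)
open import Data.Fin.Properties
  using (toℕ-fromℕ<; pigeonhole; injective⇒≤; 2↔Bool; ¬∀⟶∃¬; any?; inject≤-injective;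
    combine-injective; funToFin-finToFin; finToFun-funToFin; <⇒≢)
open import Data.List
  using (List; []; _∷_; length; filterᵇ; map; mapMaybe; allFin; lookup)
open import Data.List.Membership.Propositional using (_∈_)
open import Data.List.Membership.Propositional.Properties using (∈-lookup)
open import Data.List.Properties using (filter-all; length-tabulate; map-cong-local)
open import Data.List.Relation.Unary.All as All using (All; []; _∷_)
open import Data.List.Relation.Unary.All.Properties using (all-filter)
open import Data.List.Relation.Unary.AllPairs using ([]; _∷_)
open import Data.List.Relation.Unary.Any using (Any; here; there)
open import Data.List.Relation.Unary.Unique.Propositional using (Unique)
open import Data.List.Relation.Unary.Unique.Propositional.Properties
  using (allFin⁺; filter⁺)
open import Data.Maybe using (Maybe; just; is-just)
open import Data.Maybe.Relation.Unary.Any using (just)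
open import Data.Nat
  using (ℕ; zero; suc; _+_; _*_; _^_; _≤_; _<_; _∸_; _≤′_; ≤′-refl; ≤′-step; _≡ᵇ_;
    _/_; _%_; >-nonZero; s≤s; z≤n)
  renaming (_≟_ to _≟ⁿ_)
open import Data.Nat.DivMod using (m/n*n≤m; m≡m%n+[m/n]*n; m%n<n; m≥n⇒m/n>0)
open import Data.Nat.Properties
  using (≡ᵇ⇒≡; ≡⇒≡ᵇ; ≤∧≢⇒<; ≤-pred; ≤-total; <⇒≤; 1+n≰n; 1+n≢n; m≤n⇒m<n∨m≡n; m≤n+m;
    m≤m+n; m∸n+n≡m; m+[n∸m]≡n; suc-injective; +-assoc; +-suc; +-identityʳ; +-monoˡ-≤;
    +-monoʳ-≤; +-monoˡ-<; *-assoc; +-cancelʳ-≤; +-cancelʳ-<; n≤1+n; n≢0⇒n>0;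
    *-monoˡ-≤; *-monoʳ-≤; *-mono-≤; *-cancelˡ-≤; *-cancelʳ-<; ^-monoˡ-≤; ^-monoʳ-≤;
    ^-monoˡ-<; ^-*-assoc; module ≤-Reasoning; ≤⇒≤′; m≤n⇒m≤1+n; ≤-trans; ≤-refl;
    ≤-reflexive; +-mono-≤; +-commutativeSemigroup)
open import Data.Nat.Tactic.RingSolver using (solve-∀)
open import Data.Product using (_×_; ∃; ∃-syntax; _,_; proj₁; proj₂)
open import Data.Sum using (_⊎_; inj₁; inj₂; [_,_]′)
open import Data.Unit using (tt)
open import Data.Vec using (_∷_)
open import Data.Vec.Relation.Unary.Any using (here; there)
open import Function using (_∘_; id; Equivalence; Inverse)
open import Relation.Binary.PropositionalEquality
  using (_≡_; _≢_; _≗_; refl; sym; trans; cong; cong₂; subst; module ≡-Reasoning)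
open import Relation.Nullary using (¬_; yes; no; contradiction)
open import Relation.Nullary.Decidable using (⌊_⌋; toWitness; fromWitness)
open import Algebra.Properties.CommutativeSemigroup +-commutativeSemigroup
  using (interchange)

private
  variable
    A : Set
    n : ℕ

-- Parity and size of filtered lists.

odd : ℕ → Bool
odd zero    = false
odd (suc k) = not (odd k)

filterᵇ-cong : {p q : A → Bool} → p ≗ q → filterᵇ p ≗ filterᵇ q
filterᵇ-cong p≗q []       = refl
filterᵇ-cong {p = p} {q} p≗q (x ∷ xs) with p x | q x | p≗q x
... | true  | _ | refl = cong (x ∷_) (filterᵇ-cong p≗q xs)
... | false | _ | refl = filterᵇ-cong p≗q xs

bit : Bool → ℕ
bit true  = 1
bit false = 0

length-filterᵇ-∷ : (p : A → Bool) → ∀ x xs →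
  length (filterᵇ p (x ∷ xs)) ≡ bit (p x) + length (filterᵇ p xs)
length-filterᵇ-∷ p x xs with p x
... | true  = refl
... | false = refl

length-filterᵇ-∪ : {p q r : A → Bool} → (∀ x → T (p x) → T (q x) ⊎ T (r x)) →
  ∀ xs → length (filterᵇ p xs) ≤ length (filterᵇ q xs) + length (filterᵇ r xs)
length-filterᵇ-∪ p⊆q∪r [] = z≤n
length-filterᵇ-∪ {p = p} {q} {r} p⊆q∪r (x ∷ xs)
  rewrite length-filterᵇ-∷ p x xs | length-filterᵇ-∷ q x xs | length-filterᵇ-∷ r x xs =
  ≤-trans (+-mono-≤ (bit-∪ (p x) (q x) (r x) (p⊆q∪r x)) (length-filterᵇ-∪ p⊆q∪r xs))
          (≤-reflexive (interchange (bit (q x)) (bit (r x)) _ _))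
  where
  bit-∪ : ∀ a b c → (T a → T b ⊎ T c) → bit a ≤ bit b + bit c
  bit-∪ false b     c     _ = z≤n
  bit-∪ true  true  c     _ = s≤s z≤n
  bit-∪ true  false true  _ = s≤s z≤n
  bit-∪ true  false false f with f tt
  ... | inj₁ ()
  ... | inj₂ ()

-- Elements satisfying both predicates count twice on the right and not at all on the left, so they
-- do not affect parity. This additivity turns a coincidence of parities into an even intersection.
odd-length-filterᵇ-xor : (p q : A → Bool) → ∀ xs →
  odd (length (filterᵇ (λ x → p x xor q x) xs)) ≡
  odd (length (filterᵇ p xs)) xor odd (length (filterᵇ q xs))
odd-length-filterᵇ-xor p q [] = refl
odd-length-filterᵇ-xor p q (x ∷ xs) with ih ← odd-length-filterᵇ-xor p q xs | p x | q x
... | true  | true  = trans ih (not-xor-not (odd (length (filterᵇ p xs))) _)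
  where
  not-xor-not : ∀ a b → a xor b ≡ not a xor not b
  not-xor-not true  b = refl
  not-xor-not false b = sym (not-involutive b)
... | true  | false = trans (cong not ih) (not-distribˡ-xor (odd (length (filterᵇ p xs))) _)
... | false | true  = trans (cong not ih) (not-distribʳ-xor (odd (length (filterᵇ p xs))) _)
... | false | false = ih

lookup-injective : {xs : List A} → Unique xs → ∀ i j → lookup xs i ≡ lookup xs j → i ≡ j
lookup-injective (x∉xs ∷ _) zero    zero    _  = refl
lookup-injective (x∉xs ∷ _) zero    (suc j) eq = contradiction eq (All.lookup x∉xs (∈-lookup j))
lookup-injective (x∉xs ∷ _) (suc i) zero    eq = contradiction (sym eq) (All.lookup x∉xs (∈-lookup i))
lookup-injective (_ ∷ xs!)  (suc i) (suc j) eq = cong suc (lookup-injective xs! i j eq)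

-- Subsets of `Fin n` and their cardinalities.

elements : (Fin n → Bool) → List (Fin n)
elements p = filterᵇ p (allFin _)

count : (Fin n → Bool) → ℕ
count p = length (elements p)

count-cong : {p q : Fin n → Bool} → p ≗ q → count p ≡ count q
count-cong p≗q = cong length (filterᵇ-cong p≗q (allFin _))

elements-unique : (p : Fin n → Bool) → Unique (elements p)
elements-unique p = filter⁺ (T? ∘ p) (allFin⁺ _)

lookup-elements : (p : Fin n → Bool) → ∀ i → T (p (lookup (elements p) i))
lookup-elements p i = All.lookup (all-filter (T? ∘ p) (allFin _)) (∈-lookup i)

-- Choosing an index for each element is injective, because `g` recovers the element from its index.
count-≤-image : ∀ {h} (p : Fin n → Bool) (g : Fin h → Fin n) →
  (∀ v → T (p v) → ∃[ i ] g i ≡ v) → count p ≤ h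
count-≤-image p g onto = injective⇒≤ {f = proj₁ ∘ preimage} λ {i} {j} eq →
  lookup-injective (elements-unique p) i j
    (trans (sym (proj₂ (preimage i))) (trans (cong g eq) (proj₂ (preimage j))))
  where
  preimage : ∀ i → ∃[ k ] g k ≡ lookup (elements p) i
  preimage i = onto _ (lookup-elements p i)

-- Transversals, and a small set meeting given sets evenly.

funToFin-cong : ∀ {m k} {f g : Fin m → Fin k} → f ≗ g → funToFin f ≡ funToFin g
funToFin-cong {zero}  f≗g = refl
funToFin-cong {suc m} f≗g = cong₂ combine (f≗g zero) (funToFin-cong (f≗g ∘ suc))

module _ {h q : ℕ} (e : Fin h → Fin q → Fin n) where

  transversal : (Fin h → Fin q) → Fin n → Bool
  transversal f v = ⌊ any? (λ a → e a (f a) ≟ v) ⌋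

  transversal⁺ : ∀ f a → T (transversal f (e a (f a)))
  transversal⁺ f a = fromWitness (a , refl)

  transversal⁻ : ∀ f {v} → T (transversal f v) → ∃[ a ] e a (f a) ≡ v
  transversal⁻ f = toWitness

  count-transversal : ∀ f → count (transversal f) ≤ h
  count-transversal f = count-≤-image (transversal f) (λ a → e a (f a)) λ _ → transversal⁻ f

-- Of the q ^ h transversals of h disjoint q-sets inside A, two have the same
-- intersection parities with all F t; X is their symmetric difference.
evenSubset : ∀ {τ} (A : Fin n → Bool) (F : Fin τ → Fin n → Bool) (h q : ℕ) →
  h * q ≤ count A → 2 ^ τ < q ^ h →
  ∃[ X ] ((∀ v → T (X v) → T (A v)) × ∃ (T ∘ X) × count X ≤ h + h ×
          (∀ t → odd (count (λ v → X v ∧ F t v)) ≡ false))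
evenSubset {n} {τ} A F h q hq≤A few =
  X , X⊆A , nonempty , small , even
  where
  module Bit = Inverse 2↔Bool

  -- The first `h * q` elements of `A` are cut into `h` consecutive blocks of length `q`.
  e : Fin h → Fin q → Fin n
  e a b = lookup (elements A) (inject≤ (combine a b) hq≤A)

  e-injective : ∀ a b c d → e a b ≡ e c d → a ≡ c × b ≡ d
  e-injective a b c d eq = combine-injective a b c d
    (inject≤-injective hq≤A hq≤A _ _ (lookup-injective (elements-unique A) _ _ eq))

  parity : (Fin h → Fin q) → Fin τ → Bool
  parity f t = odd (count (λ v → transversal e f v ∧ F t v))

  -- The vector of `τ` parities is coded as a number, so that the pigeonhole principle for `Fin`
  -- applies to the `q ^ h` codes of transversals.
  signature : (Fin h → Fin q) → Fin (2 ^ τ)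
  signature f = funToFin (Bit.from ∘ parity f)

  collision : ∃[ i ] ∃[ j ] (i Fin.< j × signature (finToFun i) ≡ signature (finToFun j))
  collision = pigeonhole few (signature ∘ finToFun)

  i = proj₁ collision
  j = proj₁ (proj₂ collision)

  f g : Fin h → Fin q
  f = finToFun i
  g = finToFun j

  f≉g : ∃[ a ] f a ≢ g a
  f≉g = ¬∀⟶∃¬ h _ (λ a → f a ≟ g a) λ f≗g →
    <⇒≢ (proj₁ (proj₂ (proj₂ collision))) (begin
      i           ≡⟨ funToFin-finToFin {h} {q} i ⟨
      funToFin f  ≡⟨ funToFin-cong f≗g ⟩
      funToFin g  ≡⟨ funToFin-finToFin {h} {q} j ⟩
      j           ∎)
    where open ≡-Reasoning

  X : Fin n → Bool
  X v = transversal e f v xor transversal e g v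

  X⊆f∪g : ∀ v → T (X v) → T (transversal e f v) ⊎ T (transversal e g v)
  X⊆f∪g v with transversal e f v
  ... | true  = λ _ → inj₁ tt
  ... | false = inj₂

  transversal⊆A : ∀ f v → T (transversal e f v) → T (A v)
  transversal⊆A f v Tv with a , refl ← transversal⁻ e f Tv =
    lookup-elements A (inject≤ (combine a (f a)) hq≤A)

  X⊆A : ∀ v → T (X v) → T (A v)
  X⊆A v Xv = [ transversal⊆A f v , transversal⊆A g v ]′ (X⊆f∪g v Xv)

  f∖g⊆X : ∀ v → T (transversal e f v) → ¬ T (transversal e g v) → T (X v)
  f∖g⊆X v v∈f v∉g with transversal e f v | transversal e g v
  ... | true | false = tt
  ... | true | true  = v∉g tt

  -- Where `f` and `g` differ, the point of `f` avoids the transversal of `g`: the blocks are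
  -- disjoint, so that transversal could meet it only through its own point in the same block.
  nonempty : ∃ (T ∘ X)
  nonempty with a , fa≢ga ← f≉g = e a (f a) , f∖g⊆X _ (transversal⁺ e f a) λ in-g →
    let b , eq      = transversal⁻ e g in-g
        b≡a , gb≡fa = e-injective b (g b) a (f a) eq
    in fa≢ga (trans (sym gb≡fa) (cong g b≡a))

  small : count X ≤ h + h
  small = ≤-trans (length-filterᵇ-∪ X⊆f∪g (allFin n))
    (+-mono-≤ (count-transversal e f) (count-transversal e g))

  parity-signature : ∀ f t → Bit.to (finToFun (signature f) t) ≡ parity f t
  parity-signature f t =
    trans (cong Bit.to (finToFun-funToFin (Bit.from ∘ parity f) t)) (Bit.strictlyInverseˡ _)

  sameParity : ∀ t → parity f t ≡ parity g t
  sameParity t = begin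
    parity f t                          ≡⟨ parity-signature f t ⟨
    Bit.to (finToFun (signature f) t)   ≡⟨ cong (λ k → Bit.to (finToFun k t)) same ⟩
    Bit.to (finToFun (signature g) t)   ≡⟨ parity-signature g t ⟩
    parity g t                          ∎
    where
    open ≡-Reasoning
    same = proj₂ (proj₂ (proj₂ collision))

  even : ∀ t → odd (count (λ v → X v ∧ F t v)) ≡ false
  even t = begin
    odd (count (λ v → X v ∧ F t v))
      ≡⟨ cong odd (count-cong (λ v → ∧-distribʳ-xor (F t v) (transversal e f v) _)) ⟩
    odd (count (λ v → (transversal e f v ∧ F t v) xor (transversal e g v ∧ F t v)))
      ≡⟨ odd-length-filterᵇ-xor _ _ (allFin n) ⟩
    parity f t xor parity g t
      ≡⟨ cong (_xor parity g t) (sameParity t) ⟩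
    parity g t xor parity g t
      ≡⟨ xor-same (parity g t) ⟩
    false ∎
    where open ≡-Reasoning

-- Reception in one slot and the parity of the transmitters.

T-ext : ∀ {a b} → (T a → T b) → (T b → T a) → a ≡ b
T-ext {false} {false} _   _   = refl
T-ext {true}  {true}  _   _   = refl
T-ext {false} {true}  _   b⇒a = contradiction tt b⇒a
T-ext {true}  {false} a⇒b _   = contradiction tt a⇒b

transmits : Action A → Bool
transmits a = is-just (transmission a)

length-transmissions : ∀ {B : Set} (p : B → Bool) (act : B → Action A) → ∀ xs →
  length (mapMaybe transmission (map act (filterᵇ p xs))) ≡
  length (filterᵇ (λ x → p x ∧ transmits (act x)) xs)
length-transmissions p act [] = refl
length-transmissions p act (x ∷ xs) with p x
... | false = length-transmissions p act xs
... | true with act x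
...   | transmit m = cong suc (length-transmissions p act xs)
...   | receive    = length-transmissions p act xs
...   | inactive   = length-transmissions p act xs

∈-transmissions : ∀ {B : Set} (act : B → Action A) {m} → ∀ xs →
  m ∈ mapMaybe transmission (map act xs) → Any (λ x → act x ≡ transmit m) xs
∈-transmissions act (x ∷ xs) m∈ with act x in eq
... | receive    = there (∈-transmissions act xs m∈)
... | inactive   = there (∈-transmissions act xs m∈)
∈-transmissions act (x ∷ xs) (here refl) | transmit m = here eq
∈-transmissions act (x ∷ xs) (there m∈)  | transmit m = there (∈-transmissions act xs m∈)

reception-just : (a : Action A) (as : List (Action A)) {m : A} →
  reception a as ≡ just m → mapMaybe transmission as ≡ m ∷ []
reception-just receive as received with m ∷ [] ← mapMaybe transmission as | refl ← received = refl

module _ {B : Set} (p : B → Bool) (act : B → Action A) (xs : List B) {a : Action A} {m : A} where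

  -- Reception needs exactly one transmitter. Only the parity of 1 is kept, since parities are what
  -- the adversary can control.
  reception-odd : reception a (map act (filterᵇ p xs)) ≡ just m →
    odd (length (filterᵇ (λ x → p x ∧ transmits (act x)) xs)) ≡ true
  reception-odd received = cong odd
    (trans (sym (length-transmissions p act xs)) (cong length (reception-just a _ received)))

  reception-transmitter : reception a (map act (filterᵇ p xs)) ≡ just m →
    ∃[ x ] (T (p x) × act x ≡ transmit m)
  reception-transmitter received = _ , All.lookupAny (all-filter (T? ∘ p) xs)
    (∈-transmissions act (filterᵇ p xs) (subst (m ∈_) (sym (reception-just a _ received)) (here refl)))

-- Executions: locality, and how nodes become informed.

module _ (P : Protocol) where
  open Protocol P

  module _ (G H : Digraph n) (s : Fin n) where
    open Digraph
    private
      module G = Execution P G s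
      module H = Execution P H s

    -- Induction on time: a node of `S` hears only nodes of `S`, which have acted alike in both
    -- networks so far.
    history-local : {S : Fin n → Set} →
      (∀ u v → S v → edge G u v ≡ edge H u v) →
      (∀ u v → S v → T (edge G u v) → S u) →
      ∀ t v → S v → G.history t v ≡ H.history t v
    history-local {S} same closed = go
      where
      go : ∀ t v → S v → G.history t v ≡ H.history t v
      go zero    v _  = refl
      go (suc t) v Sv = cong₂ _∷_ (cong₂ reception (act v Sv) heard) (go t v Sv)
        where
        act : ∀ u → S u → G.actionAt t (G.history t) u ≡ H.actionAt t (H.history t) u
        act u Su = cong (action (G.isSource u) (toℕ u) t) (go t u Su)

        heard = trans
          (map-cong-local (All.map (λ {u} → act u ∘ closed u v Sv)
                                   (all-filter (T? ∘ λ u → edge G u v) (allFin n))))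
          (cong (map _) (filterᵇ-cong (λ u → same u v Sv) (allFin n)))

  module _ (G : Digraph n) (s : Fin n) where
    open Digraph G
    open Execution P G s

    Informed : ℕ → Fin n → Set
    Informed t v = Holds (isSource v) (history t v)

    informed-mono : ∀ {t t′ v} → t ≤ t′ → Informed t v → Informed t′ v
    informed-mono t≤t′ = go (≤⇒≤′ t≤t′)
      where
      go : ∀ {t t′ v} → t ≤′ t′ → Informed t v → Informed t′ v
      go ≤′-refl        = id
      go (≤′-step t≤t′) = [ inj₁ , inj₂ ∘ there ]′ ∘ go t≤t′

    receptionAt : ℕ → Fin n → Maybe Msg
    receptionAt t v = reception (act v) (map act (inNeighbours v))
      where act = actionAt t (history t)

    received⇒odd : ∀ t v {m} → receptionAt t v ≡ just m →
      odd (count (λ u → edge u v ∧ transmits (actionAt t (history t) u))) ≡ true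
    received⇒odd t v = reception-odd (λ u → edge u v) (actionAt t (history t)) (allFin n)
                         {a = actionAt t (history t) v}

    received⇒sent : ∀ t v {m} → receptionAt t v ≡ just m →
      ∃[ u ] (T (edge u v) × actionAt t (history t) u ≡ transmit m)
    received⇒sent t v = reception-transmitter (λ u → edge u v) (actionAt t (history t)) (allFin n)
                          {a = actionAt t (history t) v}

    -- Traces possession of the source message back to a single slot, in which reception can then be
    -- refuted.
    informed⇒received : ∀ t v → v ≢ s → Informed t v →
      ∃[ t′ ] (t′ < t × ∃[ m ] (receptionAt t′ v ≡ just m × T (carries m)))
    informed⇒received t v v≢s (inj₁ v≡s) = contradiction (toWitness v≡s) v≢s
    informed⇒received (suc t) v v≢s (inj₂ (here c)) with receptionAt t v in eq | c
    ... | just m | just m-carries = t , ≤-refl , m , eq , m-carries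
    informed⇒received (suc t) v v≢s (inj₂ (there c))
      with t′ , t′<t , received ← informed⇒received t v v≢s (inj₂ c) =
      t′ , m≤n⇒m≤1+n t′<t , received

-- Layered networks and their eccentricities.

layered : (Fin n → ℕ) → Digraph n
layered level = record
  { edge     = λ u v → level v ≡ᵇ suc (level u)
  ; loopless = λ v → n≢ᵇ1+n (level v)
  }
  where
  n≢ᵇ1+n : ∀ k → (k ≡ᵇ suc k) ≡ false
  n≢ᵇ1+n zero    = refl
  n≢ᵇ1+n (suc k) = n≢ᵇ1+n k

-- With `i` on the left of the comparison, the in-degree of a node of level `suc i` reduces to the
-- size of level `i` by computation.
∣level_∣ : (Fin n → ℕ) → ℕ → ℕ
∣level ℓ ∣ i = count (λ v → i ≡ᵇ ℓ v)

level-inhabited : (ℓ : Fin n → ℕ) → ∀ i → 0 < ∣level ℓ ∣ i → ∃[ v ] ℓ v ≡ i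
level-inhabited ℓ i 0<level =
  _ , sym (≡ᵇ⇒≡ i _ (lookup-elements (λ v → i ≡ᵇ ℓ v) (fromℕ< 0<level)))

count-true : count {n} (λ _ → true) ≡ n
count-true {n} = trans (cong length (filter-all (T? ∘ λ _ → true) (All.universal _ (allFin n))))
                       (length-tabulate {n = n} id)

module _ {ℓ : Fin n → ℕ} where

  -- Every edge climbs exactly one level, so distances can be read off from the levels.
  walk-level : ∀ {u v k} → Walk (layered ℓ) u v k → ℓ v ≡ k + ℓ u
  walk-level []                  = refl
  walk-level (_∷ʳ_ {w = w} vs e) = trans (≡ᵇ⇒≡ (ℓ w) _ e) (cong suc (walk-level vs))

  module _ {s D} (inhabited : ∀ i → i ≤ D → ∃[ v ] ℓ v ≡ i)
                 (onlySource : ∀ v → ℓ v ≡ 0 → v ≡ s) where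

    -- Consecutive levels are completely joined, so any node of the level below serves as
    -- predecessor.
    walk-to : ∀ i → i ≤ D → ∀ v → ℓ v ≡ i → Walk (layered ℓ) s v i
    walk-to zero    _   v eq with refl ← onlySource v eq = []
    walk-to (suc i) i<D v eq with u , u-level ← inhabited i (<⇒≤ i<D) =
      walk-to i (<⇒≤ i<D) u u-level ∷ʳ ≡⇒≡ᵇ _ _ (trans eq (cong suc (sym u-level)))

    maxEccentricity : ℓ s ≡ 0 → (∀ v → ℓ v ≤ D) → IsMaxEccentricity (layered ℓ) D
    maxEccentricity sourceLevel bounded =
      (s , (v , walk-to D ≤-refl v v-level , shortest) , λ w d (walk , _) → walk-≤ walk) ,
      λ { _ _ ((_ , walk , _) , _) → walk-≤ walk }
      where
      v       = proj₁ (inhabited D ≤-refl)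
      v-level = proj₂ (inhabited D ≤-refl)

      walk-≤ : ∀ {u w k} → Walk (layered ℓ) u w k → k ≤ D
      walk-≤ {u} {w} {k} walk =
        ≤-trans (m≤m+n k (ℓ u)) (subst (_≤ D) (walk-level walk) (bounded w))

      shortest : ∀ k → Walk (layered ℓ) s v k → D ≤ k
      shortest k walk = ≤-reflexive (begin
        D        ≡⟨ v-level ⟨
        ℓ v      ≡⟨ walk-level walk ⟩
        k + ℓ s  ≡⟨ cong (k +_) sourceLevel ⟩
        k + 0    ≡⟨ +-identityʳ k ⟩
        k        ∎)
        where open ≡-Reasoning

-- The adversary fixes the levels one after the other.

module Construction (P : Protocol) (s : Fin n) (h q τ : ℕ)
                    (0<hq : 0 < h * q) (few : 2 ^ τ < q ^ h) where
  open Protocol P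
  open Execution using (history; actionAt)

  -- Levels 0, …, j of the final graph are fixed, and level suc j still
  -- contains all the other nodes.
  record Stage (j : ℕ) (ℓ : Fin n → ℕ) : Set where
    field
      bounded     : ∀ v → ℓ v ≤ suc j
      inhabited   : ∀ i → i ≤ suc j → ∃[ v ] ℓ v ≡ i
      sourceLevel : ℓ s ≡ 0
      onlySource  : ∀ v → ℓ v ≡ 0 → v ≡ s
      narrow      : ∀ i → i ≤ j → ∣level ℓ ∣ i ≤ h + h
      -- The `suc` accounts for the source on level 0, the product for levels 1 to `j`.
      large       : n ≤ ∣level ℓ ∣ (suc j) + suc (j * (h + h))
      -- The factor is `j`, not `suc j`, because level 1 can hear the source already in slot 0.
      uninformed  : ∀ v → ℓ v ≡ suc j → ¬ Informed P (layered ℓ) s (j * τ) v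

  module _ {j ℓ} (stage : Stage j ℓ) where
    open Stage stage

    G : Digraph n
    G = layered ℓ

    pool : Fin n → Bool
    pool v = suc j ≡ᵇ ℓ v

    -- Taken from the run on `G`, before `X` is chosen. This is not circular: `action-agree` shows
    -- that the chosen nodes act the same after the choice.
    transmitters : Fin τ → Fin n → Bool
    transmitters i v = transmits (actionAt P G s t (history P G s t) v)
      where t = j * τ + toℕ i

    module Step (room : h * q + suc (suc j * (h + h)) ≤ n)
                (X : Fin n → Bool) (X⊆pool : ∀ v → T (X v) → T (pool v))
                (X-inhabited : ∃ (T ∘ X)) (X-small : count X ≤ h + h)
                (X-even : ∀ i → odd (count (λ v → X v ∧ transmitters i v)) ≡ false) where

      ℓ′ : Fin n → ℕ
      ℓ′ v = if pool v ∧ not (X v) then suc (suc j) else ℓ v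

      G′ : Digraph n
      G′ = layered ℓ′

      X-level : ∀ v → T (X v) → suc j ≡ ℓ v
      X-level v Xv = ≡ᵇ⇒≡ (suc j) (ℓ v) (X⊆pool v Xv)

      data Fate (v : Fin n) : Set where
        lower    : ¬ T (X v) → ℓ v ≤ j → ℓ′ v ≡ ℓ v → Fate v
        chosen   : T (X v) → ℓ v ≡ suc j → ℓ′ v ≡ suc j → Fate v
        promoted : ¬ T (X v) → ℓ v ≡ suc j → ℓ′ v ≡ suc (suc j) → Fate v

      fate : ∀ v → Fate v
      fate v with suc j ≟ⁿ ℓ v | T? (X v)
      ... | yes eq | yes Xv = chosen Xv (sym eq) (trans ℓ′≡ℓ (sym eq))
        where
        ℓ′≡ℓ : ℓ′ v ≡ ℓ v
        ℓ′≡ℓ rewrite Equivalence.to T-≡ Xv | ∧-zeroʳ (pool v) = refl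
      ... | yes eq | no ¬Xv = promoted ¬Xv (sym eq) ℓ′≡
        where
        ℓ′≡ : ℓ′ v ≡ suc (suc j)
        ℓ′≡ rewrite Equivalence.to T-≡ (≡⇒≡ᵇ (suc j) (ℓ v) eq)
                  | ¬-not (¬Xv ∘ Equivalence.from T-≡) = refl
      ... | no neq | yes Xv = contradiction (X-level v Xv) neq
      ... | no neq | no ¬Xv = lower ¬Xv (≤-pred (≤∧≢⇒< (bounded v) (neq ∘ sym))) ℓ′≡ℓ
        where
        ℓ′≡ℓ : ℓ′ v ≡ ℓ v
        ℓ′≡ℓ rewrite ¬-not (neq ∘ ≡ᵇ⇒≡ (suc j) (ℓ v) ∘ Equivalence.from T-≡) = refl

      low⇒same : ∀ v → ℓ′ v ≤ suc j → ℓ′ v ≡ ℓ v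
      low⇒same v low with fate v
      ... | lower _ _ eq      = eq
      ... | chosen _ eq eq′   = trans eq′ (sym eq)
      ... | promoted _ _ eq′  = contradiction (subst (_≤ suc j) eq′ low) 1+n≰n

      level-suc-j : ∀ v → ℓ′ v ≡ suc j → T (X v)
      level-suc-j v eq with fate v
      ... | chosen Xv _ _    = Xv
      ... | lower _ ≤j same  = contradiction (subst (_≤ j) (trans (sym same) eq) ≤j) 1+n≰n
      ... | promoted _ _ eq′ = contradiction (trans (sym eq) eq′) (1+n≢n ∘ sym)

      chosen-level : ∀ v → T (X v) → ℓ′ v ≡ suc j
      chosen-level v Xv with fate v
      ... | chosen _ _ eq′   = eq′
      ... | lower ¬Xv _ _    = contradiction Xv ¬Xv
      ... | promoted ¬Xv _ _ = contradiction Xv ¬Xv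

      edges-agree : ∀ u v → ℓ′ v ≤ suc j → Digraph.edge G′ u v ≡ Digraph.edge G u v
      edges-agree u v low with fate u
      ... | lower _ _ eq     = cong₂ (λ a b → a ≡ᵇ suc b) (low⇒same v low) eq
      ... | chosen _ eq eq′  = cong₂ (λ a b → a ≡ᵇ suc b) (low⇒same v low) (trans eq′ (sym eq))
      -- A promoted node has edges only to levels above `suc j`, both before and after, so neither
      -- network has an edge from it to `v`.
      ... | promoted _ eq eq′ rewrite eq | eq′ | low⇒same v low = T-ext
        (λ e → contradiction (subst (_≤ suc j) (≡ᵇ⇒≡ (ℓ v) _ e) (bounded v)) (1+n≰n ∘ <⇒≤))
        (λ e → contradiction (subst (_≤ suc j) (≡ᵇ⇒≡ (ℓ v) _ e) (bounded v)) 1+n≰n)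

      -- The levels up to `suc j` are closed under in-neighbours, and the two networks agree on the
      -- edges into them.
      history-agree : ∀ t v → ℓ′ v ≤ suc j → history P G′ s t v ≡ history P G s t v
      history-agree = history-local P G′ G s edges-agree
        (λ u v low e → ≤-trans (<⇒≤ (≤-reflexive (sym (≡ᵇ⇒≡ (ℓ′ v) _ e)))) low)

      pool′ : Fin n → Bool
      pool′ v = suc (suc j) ≡ᵇ ℓ′ v

      large′ : n ≤ count pool′ + suc (suc j * (h + h))
      large′ = begin
        n                                     ≤⟨ large ⟩
        count pool + suc (j * w)              ≤⟨ +-monoˡ-≤ _ (length-filterᵇ-∪ split (allFin n)) ⟩
        count pool′ + count X + suc (j * w)   ≤⟨ +-monoˡ-≤ _ (+-monoʳ-≤ (count pool′) X-small) ⟩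
        count pool′ + w + suc (j * w)         ≡⟨ +-assoc (count pool′) w _ ⟩
        count pool′ + (w + suc (j * w))       ≡⟨ cong (count pool′ +_) (+-suc w _) ⟩
        count pool′ + suc (suc j * w)         ∎
        where
        open ≤-Reasoning
        w = h + h
        split : ∀ v → T (pool v) → T (pool′ v) ⊎ T (X v)
        split v Pv with fate v
        ... | lower _ ≤j _     = contradiction (subst (_≤ j) (sym (≡ᵇ⇒≡ (suc j) (ℓ v) Pv)) ≤j) 1+n≰n
        ... | chosen Xv _ _    = inj₂ Xv
        ... | promoted _ _ eq′ = inj₁ (≡⇒≡ᵇ _ _ (sym eq′))

      pool′-inhabited : ∃[ v ] ℓ′ v ≡ suc (suc j)
      pool′-inhabited = level-inhabited ℓ′ (suc (suc j))
        -- Comparing `room` with `large′` leaves at least `h * q` nodes, hence at least one, in the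
        -- new pool.
        (≤-trans 0<hq (+-cancelʳ-≤ (suc (suc j * (h + h))) _ _ (≤-trans room large′)))

      inhabited′ : ∀ i → i ≤ suc (suc j) → ∃[ v ] ℓ′ v ≡ i
      inhabited′ i i≤2+j with m≤n⇒m<n∨m≡n i≤2+j
      ... | inj₂ refl = pool′-inhabited
      ... | inj₁ (s≤s i≤1+j) with m≤n⇒m<n∨m≡n i≤1+j
      ...   | inj₂ refl = proj₁ X-inhabited , chosen-level _ (proj₂ X-inhabited)
      ...   | inj₁ (s≤s i≤j) with v , eq ← inhabited i i≤1+j | fate v
      ...     | lower _ _ same   = v , trans same eq
      ...     | chosen _ eq′ _   = contradiction (subst (_≤ j) (trans (sym eq) eq′) i≤j) 1+n≰n
      ...     | promoted _ eq′ _ = contradiction (subst (_≤ j) (trans (sym eq) eq′) i≤j) 1+n≰n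

      bounded′ : ∀ v → ℓ′ v ≤ suc (suc j)
      bounded′ v with fate v
      ... | lower _ ≤j same  = subst (_≤ suc (suc j)) (sym same) (m≤n⇒m≤1+n (m≤n⇒m≤1+n ≤j))
      ... | chosen _ _ eq′   = subst (_≤ suc (suc j)) (sym eq′) (m≤n⇒m≤1+n ≤-refl)
      ... | promoted _ _ eq′ = ≤-reflexive eq′

      sourceLevel′ : ℓ′ s ≡ 0
      sourceLevel′ with fate s
      ... | lower _ _ same  = trans same sourceLevel
      ... | chosen _ eq _   = contradiction (trans (sym sourceLevel) eq) λ ()
      ... | promoted _ eq _ = contradiction (trans (sym sourceLevel) eq) λ ()

      onlySource′ : ∀ v → ℓ′ v ≡ 0 → v ≡ s
      onlySource′ v eq = onlySource v (trans (sym (low⇒same v (subst (_≤ suc j) (sym eq) z≤n))) eq)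

      narrow′ : ∀ i → i ≤ suc j → ∣level ℓ′ ∣ i ≤ h + h
      narrow′ i i≤1+j with m≤n⇒m<n∨m≡n i≤1+j
      ... | inj₁ (s≤s i≤j) =
        ≤-trans (≤-reflexive (count-cong λ v → T-ext (to v) (from v))) (narrow i i≤j)
        where
        to : ∀ v → T (i ≡ᵇ ℓ′ v) → T (i ≡ᵇ ℓ v)
        to v e = ≡⇒≡ᵇ _ _ (trans eq (low⇒same v (subst (_≤ suc j) eq i≤1+j)))
          where eq = ≡ᵇ⇒≡ i (ℓ′ v) e
        from : ∀ v → T (i ≡ᵇ ℓ v) → T (i ≡ᵇ ℓ′ v)
        from v e with fate v
        ... | lower _ _ same  = ≡⇒≡ᵇ _ _ (trans (≡ᵇ⇒≡ i (ℓ v) e) (sym same))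
        ... | chosen _ eq _   = contradiction (subst (_≤ j) (trans (≡ᵇ⇒≡ i (ℓ v) e) eq) i≤j) 1+n≰n
        ... | promoted _ eq _ = contradiction (subst (_≤ j) (trans (≡ᵇ⇒≡ i (ℓ v) e) eq) i≤j) 1+n≰n
      ... | inj₂ refl = ≤-trans
        (≤-reflexive (count-cong λ v → T-ext (level-suc-j v ∘ sym ∘ ≡ᵇ⇒≡ (suc j) (ℓ′ v))
                                             (≡⇒≡ᵇ (suc j) (ℓ′ v) ∘ sym ∘ chosen-level v)))
        X-small

      action-agree : ∀ t u → ℓ′ u ≡ suc j →
        actionAt P G′ s t (history P G′ s t) u ≡ actionAt P G s t (history P G s t) u
      action-agree t u eq = cong (action _ (toℕ u) t) (history-agree t u (≤-reflexive eq))

      -- Up to slot j * τ, the chosen nodes do not hold the source message.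
      early : ∀ t u m → ℓ′ u ≡ suc j → t ≤ j * τ →
        actionAt P G′ s t (history P G′ s t) u ≡ transmit m → ¬ T (carries m)
      early t u m level t≤jτ sent m-carries =
        uninformed u (trans (sym (low⇒same u (≤-reflexive level))) level)
          (informed-mono P G s t≤jτ
            (no-forgery _ _ t _ m (trans (sym (action-agree t u level)) sent) m-carries))

      -- In the next τ slots, the number of chosen nodes that transmit is even.
      late : ∀ i v {m} → ℓ′ v ≡ suc (suc j) → receptionAt P G′ s (j * τ + toℕ i) v ≢ just m
      late i v v-level received = contradiction
        (trans (sym (received⇒odd P G′ s _ v received)) (trans (cong odd (count-cong same)) (X-even i)))
        λ ()
        where
        t = j * τ + toℕ i
        -- Complete joining makes `X` the exact set of in-neighbours of `v`, so `X-even` governs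
        -- what `v` hears.
        edge≡X : ∀ u → Digraph.edge G′ u v ≡ X u
        edge≡X u = T-ext
          (λ e → level-suc-j u (suc-injective (trans (sym (≡ᵇ⇒≡ (ℓ′ v) _ e)) v-level)))
          (λ Xu → ≡⇒≡ᵇ _ _ (trans v-level (cong suc (sym (chosen-level u Xu)))))
        -- The actions in the two runs are known to agree on `X` only; promoted nodes may behave
        -- differently.
        ∧-cong : ∀ a {b c} → (T a → b ≡ c) → a ∧ b ≡ a ∧ c
        ∧-cong false _  = refl
        ∧-cong true  eq = eq tt
        transmits′ : Fin n → Bool
        transmits′ u = transmits (actionAt P G′ s t (history P G′ s t) u)
        same : ∀ u → Digraph.edge G′ u v ∧ transmits′ u ≡ X u ∧ transmitters i u
        same u = trans (cong (_∧ transmits′ u) (edge≡X u))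
          (∧-cong (X u) λ Xu → cong transmits (action-agree t u (chosen-level u Xu)))

      notReceived : ∀ t v m → ℓ′ v ≡ suc (suc j) → t < τ + j * τ →
        receptionAt P G′ s t v ≡ just m → ¬ T (carries m)
      -- Before slot `j * τ` a reception is possible but cannot carry the source message; from then
      -- on parity excludes any reception.
      notReceived t v m v-level t<τ+jτ received m-carries = [ before , after ]′ (≤-total t (j * τ))
        where
        before : ¬ t ≤ j * τ
        before t≤jτ =
          let u , edge-uv , sent = received⇒sent P G′ s t v received
              u-level = suc-injective (trans (sym (≡ᵇ⇒≡ (ℓ′ v) _ edge-uv)) v-level)
          in early t u m u-level t≤jτ sent m-carries

        after : ¬ j * τ ≤ t
        after jτ≤t = late (fromℕ< offset<) v v-level
          (subst (λ t → receptionAt P G′ s t v ≡ just m) (sym slot) received)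
          where
          offset< : t ∸ j * τ < τ
          offset< = +-cancelʳ-< (j * τ) _ _ (subst (_< τ + j * τ) (sym (m∸n+n≡m jτ≤t)) t<τ+jτ)
          slot : j * τ + toℕ (fromℕ< offset<) ≡ t
          slot = trans (cong (j * τ +_) (toℕ-fromℕ< offset<)) (m+[n∸m]≡n jτ≤t)

      uninformed′ : ∀ v → ℓ′ v ≡ suc (suc j) → ¬ Informed P G′ s (suc j * τ) v
      uninformed′ v v-level informed =
        let t , t<τ+jτ , m , received , m-carries =
              informed⇒received P G′ s (suc j * τ) v v≢s informed
        in notReceived t v m v-level t<τ+jτ received m-carries
        where
        v≢s : v ≢ s
        v≢s v≡s = contradiction (trans (sym sourceLevel′) (trans (cong ℓ′ (sym v≡s)) v-level)) λ ()

      next : Stage (suc j) ℓ′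
      next = record
        { bounded     = bounded′
        ; inhabited   = inhabited′
        ; sourceLevel = sourceLevel′
        ; onlySource  = onlySource′
        ; narrow      = narrow′
        ; large       = large′
        ; uninformed  = uninformed′
        }

    pool-large : h * q + suc (suc j * (h + h)) ≤ n → h * q ≤ count pool
    pool-large room = +-cancelʳ-≤ (suc (j * (h + h))) _ _
      (≤-trans (+-monoʳ-≤ (h * q) (s≤s (m≤n+m (j * (h + h)) (h + h)))) (≤-trans room large))

    step : h * q + suc (suc j * (h + h)) ≤ n → ∃ (Stage (suc j))
    step room =
      let X , X⊆pool , X-inhabited , X-small , X-even =
            evenSubset pool transmitters h q (pool-large room) few
      in _ , Step.next room X X⊆pool X-inhabited X-small X-even

  first : h * q + 1 ≤ n → ∃ (Stage 0)
  first room = ℓ , record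
    { bounded     = bounded
    ; inhabited   = inhabited
    ; sourceLevel = sourceLevel
    ; onlySource  = onlySource
    ; narrow      = λ { zero z≤n → ≤-trans rootAlone (≤-trans 0<h (m≤m+n h h)) }
    ; large       = large
    ; uninformed  = uninformed
    }
    where
    ℓ : Fin n → ℕ
    ℓ v = if ⌊ v ≟ s ⌋ then 0 else 1

    bounded : ∀ v → ℓ v ≤ 1
    bounded v with v ≟ s
    ... | yes _ = z≤n
    ... | no  _ = ≤-refl

    sourceLevel : ℓ s ≡ 0
    sourceLevel with s ≟ s
    ... | yes _  = refl
    ... | no s≢s = contradiction refl s≢s

    onlySource : ∀ v → ℓ v ≡ 0 → v ≡ s
    onlySource v eq with v ≟ s
    ... | yes v≡s = v≡s

    0<h : 0 < h
    0<h = n≢0⇒n>0 λ h≡0 → contradiction (subst (λ h → 0 < h * q) h≡0 0<hq) λ ()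

    rootAlone : ∣level ℓ ∣ 0 ≤ 1
    rootAlone = count-≤-image {h = 1} (λ v → 0 ≡ᵇ ℓ v) (λ _ → s)
      λ v e → zero , sym (onlySource v (sym (≡ᵇ⇒≡ 0 (ℓ v) e)))

    large : n ≤ ∣level ℓ ∣ 1 + 1
    large = begin
      n                             ≡⟨ count-true ⟨
      count {n} (λ _ → true)        ≤⟨ length-filterᵇ-∪ split (allFin n) ⟩
      ∣level ℓ ∣ 1 + ∣level ℓ ∣ 0   ≤⟨ +-monoʳ-≤ (∣level ℓ ∣ 1) rootAlone ⟩
      ∣level ℓ ∣ 1 + 1              ∎
      where
      open ≤-Reasoning
      split : ∀ v → T true → T (1 ≡ᵇ ℓ v) ⊎ T (0 ≡ᵇ ℓ v)
      split v _ with v ≟ s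
      ... | yes _ = inj₂ tt
      ... | no  _ = inj₁ tt

    inhabited : ∀ i → i ≤ 1 → ∃[ v ] ℓ v ≡ i
    inhabited zero       _ = s , sourceLevel
    inhabited (suc zero) _ = level-inhabited ℓ 1
      (≤-trans 0<hq (+-cancelʳ-≤ 1 _ _ (≤-trans room large)))
    inhabited (suc (suc _)) (s≤s ())

    -- After zero slots the history is empty, so only the source could hold the message.
    uninformed : ∀ v → ℓ v ≡ 1 → ¬ Informed P (layered ℓ) s 0 v
    uninformed v eq (inj₁ v≡s) with refl ← toWitness v≡s =
      contradiction (trans (sym sourceLevel) eq) λ ()

  stages : ∀ j → h * q + suc (j * (h + h)) ≤ n → ∃ (Stage j)
  stages zero    room = first room
  stages (suc j) room = step (proj₂ (stages j previousRoom)) room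
    where previousRoom = ≤-trans (+-monoʳ-≤ (h * q) (s≤s (m≤n+m _ (h + h)))) room

  module _ {j ℓ} (stage : Stage j ℓ) where
    open Stage stage

    -- The in-neighbours of a node form the whole level below it. The last level may be wide, but it
    -- has no outgoing edges.
    inDegree-≤ : ∀ v → Digraph.inDegree (layered ℓ) v ≤ h + h
    inDegree-≤ v with ℓ v | bounded v
    ... | zero  | _       = ≤-trans (count-≤-image {n = n} {h = 0} (λ _ → false) (λ ()) λ _ ()) z≤n
    ... | suc i | s≤s i≤j = narrow i i≤j

    completion-≥ : ∀ {t} → CompletesWithin P (layered ℓ) s t → j * τ ≤ t
    completion-≥ {t} complete with ≤-total (j * τ) t | inhabited (suc j) ≤-refl
    ... | inj₁ jτ≤t | _ = jτ≤t
    ... | inj₂ t≤jτ | v , v-level = contradiction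
      (informed-mono P (layered ℓ) s t≤jτ
        (complete v (suc j , walk-to inhabited onlySource (suc j) ≤-refl v v-level)))
      (uninformed v v-level)

-- Arithmetic of the parameters and of logarithms.

powerBelow : ∀ q → 3 ≤ q → ∃[ g ] (1 ≤ g × 2 ^ g < q × q ≤ 2 ^ suc g)
-- Here `suc g` is the binary logarithm of the argument rounded up; an argument of at least 3 makes
-- `g` positive.
powerBelow (suc q) 3≤1+q with m≤n⇒m<n∨m≡n 3≤1+q
... | inj₂ refl = 1 , ≤-refl , ≤-refl , n≤1+n 3
... | inj₁ (s≤s 3≤q) with g , 1≤g , lo , hi ← powerBelow q 3≤q with m≤n⇒m<n∨m≡n hi
...   | inj₁ hi<   = g , 1≤g , m≤n⇒m≤1+n lo , hi<
...   | inj₂ refl  = suc g , s≤s z≤n , ≤-refl ,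
  +-mono-≤ (≤-trans (s≤s z≤n) 3≤q) (≤-reflexive (sym (+-identityʳ _)))

regroup-width : ∀ D h → 2 * (D * (h + h)) ≡ (h * 4) * D
regroup-width = solve-∀

-- h + h is the width of the levels: about Δ / 2, to leave half of the labels
-- unused, but at least 2, since a single node cannot collide.
levelWidth : ∀ n D Δ → 2 ≤ Δ → 6 * D ≤ n → Δ * D ≤ n →
  ∃[ h ] (1 ≤ h × h + h ≤ Δ × Δ ≤ 7 * h × 2 * (D * (h + h)) ≤ n)
levelWidth n D Δ 2≤Δ 6D≤n ΔD≤n with ≤-total 4 Δ
-- For small `Δ` the levels have width 2, and `6 * D ≤ n` provides the space.
... | inj₂ Δ≤4 = 1 , ≤-refl , 2≤Δ , ≤-trans Δ≤4 (m≤m+n 4 3) , (begin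
  2 * (D * 2)  ≡⟨ regroup-width D 1 ⟩
  4 * D        ≤⟨ *-monoˡ-≤ D (m≤m+n 4 2) ⟩
  6 * D        ≤⟨ 6D≤n ⟩
  n            ∎)
  where open ≤-Reasoning
... | inj₁ 4≤Δ = h , 1≤h , 2h≤Δ , Δ≤7h , (begin
  2 * (D * (h + h)) ≡⟨ regroup-width D h ⟩
  (h * 4) * D       ≤⟨ *-monoˡ-≤ D (m/n*n≤m Δ 4) ⟩
  Δ * D             ≤⟨ ΔD≤n ⟩
  n                 ∎)
  where
  open ≤-Reasoning
  h = Δ / 4
  double : ∀ h → h + h + (h + h) ≡ h * 4
  double = solve-∀
  seven : ∀ h → 3 * h + h * 4 ≡ 7 * h
  seven = solve-∀
  1≤h : 1 ≤ h
  1≤h = m≥n⇒m/n>0 4≤Δ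
  2h≤Δ : h + h ≤ Δ
  2h≤Δ = begin
    h + h              ≤⟨ m≤m+n (h + h) (h + h) ⟩
    h + h + (h + h)    ≡⟨ double h ⟩
    h * 4              ≤⟨ m/n*n≤m Δ 4 ⟩
    Δ                  ∎
  -- The remainder modulo 4 is at most 3, hence at most `3 * h`.
  Δ≤7h : Δ ≤ 7 * h
  Δ≤7h = begin
    Δ                  ≡⟨ m≡m%n+[m/n]*n Δ 4 ⟩
    Δ % 4 + h * 4      ≤⟨ +-monoˡ-≤ (h * 4) (≤-pred (m%n<n Δ 4)) ⟩
    3 * 1 + h * 4      ≤⟨ +-monoˡ-≤ (h * 4) (*-monoʳ-≤ 3 1≤h) ⟩
    3 * h + h * 4      ≡⟨ seven h ⟩
    7 * h              ∎

-- The quotient of `n` by `w` works: two levels of width `w` fit into half of the labels, so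
-- `4 * w ≤ n`, and the quotient is at least 3, as `powerBelow` requires.
blockSize : ∀ n D w → 2 ≤ D → 1 ≤ w → 2 * (D * w) ≤ n →
  ∃[ q ] (3 ≤ q × q * w ≤ n × n ≤ suc q * w)
blockSize n D w@(suc _) 2≤D _ 2Dw≤n = q , ≤-pred (*-cancelʳ-< w 3 (suc q) 3w<) , m/n*n≤m n w , <⇒≤ n<
  where
  open ≤-Reasoning
  q = n / w
  n< : n < suc q * w
  n< = begin-strict
    n              ≡⟨ m≡m%n+[m/n]*n n w ⟩
    n % w + q * w  <⟨ +-monoˡ-< (q * w) (m%n<n n w) ⟩
    w + q * w      ∎
  3w< : 3 * w < suc q * w
  3w< = begin-strict
    3 * w        ≤⟨ *-monoˡ-≤ w (n≤1+n 3) ⟩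
    4 * w        ≡⟨ *-assoc 2 2 w ⟩
    2 * (2 * w)  ≤⟨ *-monoʳ-≤ 2 (*-monoˡ-≤ w 2≤D) ⟩
    2 * (D * w)  ≤⟨ 2Dw≤n ⟩
    n            <⟨ n< ⟩
    suc q * w    ∎

^-distribʳ-* : ∀ a b k → (a * b) ^ k ≡ a ^ k * b ^ k
^-distribʳ-* a b zero    = refl
^-distribʳ-* a b (suc k) = trans (cong (a * b *_) (^-distribʳ-* a b k)) (swap a b (a ^ k) (b ^ k))
  where
  swap : ∀ a b c d → a * b * (c * d) ≡ a * c * (b * d)
  swap = solve-∀

-- The first hypothesis bounds the logarithm by `r`; raising it to the power `a` gives the claim.
·log₂-bound : ∀ {a b p q} r → p ≤ 2 ^ r * q → r * a ≤ b → a ·log₂[ p / q ]≤ b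
·log₂-bound {a} {b} {p} {q} r p≤2ʳq ra≤b = begin
  p ^ a                ≤⟨ ^-monoˡ-≤ a p≤2ʳq ⟩
  (2 ^ r * q) ^ a      ≡⟨ ^-distribʳ-* (2 ^ r) q a ⟩
  (2 ^ r) ^ a * q ^ a  ≡⟨ cong (_* q ^ a) (^-*-assoc 2 r a) ⟩
  2 ^ (r * a) * q ^ a  ≤⟨ *-monoˡ-≤ (q ^ a) (^-monoʳ-≤ 2 ra≤b) ⟩
  2 ^ b * q ^ a        ∎
  where open ≤-Reasoning

-- The ratio of `n` to `w` is at most `suc q`, hence at most `2 ^ (g + 2)`, and `g + 2 ≤ 3 * g`
-- because `g` is positive.
logBound : ∀ {n w Δ} q g → 1 ≤ g → w ≤ Δ → n ≤ suc q * w → q ≤ 2 ^ suc g →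
  n ≤ 2 ^ (3 * g) * Δ
logBound {n} {w} {Δ} q g 1≤g w≤Δ n≤ q≤ = begin
  n                      ≤⟨ n≤ ⟩
  suc q * w              ≤⟨ *-mono-≤ 1+q≤ w≤Δ ⟩
  2 ^ (3 * g) * Δ        ∎
  where
  open ≤-Reasoning
  1+q≤ : suc q ≤ 2 ^ (3 * g)
  1+q≤ = begin
    1 + q                  ≤⟨ +-mono-≤ (^-monoʳ-≤ 2 {0} {suc g} z≤n) q≤ ⟩
    2 ^ suc g + 2 ^ suc g  ≡⟨ cong (2 ^ suc g +_) (+-identityʳ _) ⟨
    2 ^ suc (suc g)        ≤⟨ ^-monoʳ-≤ 2 (+-mono-≤ (+-mono-≤ 1≤g 1≤g) (≤-refl {g})) ⟩
    2 ^ (g + g + g)        ≡⟨ cong (2 ^_) (triple g) ⟩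
    2 ^ (3 * g)            ∎
    where
    triple : ∀ g → g + g + g ≡ 3 * g
    triple = solve-∀

-- The hard network and the count of its slots.

module _ {n j h q g Δ : ℕ} (P : Protocol)
         (1≤j : 1 ≤ j) (1≤h : 1 ≤ h) (1≤g : 1 ≤ g) (2h≤Δ : h + h ≤ Δ) (Δ≤7h : Δ ≤ 7 * h)
         (levels-fit : 2 * (suc j * (h + h)) ≤ n)
         (blocks-fit : q * (h + h) ≤ n) (blocks-max : n ≤ suc q * (h + h))
         (2^g<q : 2 ^ g < q) (q≤2^1+g : q ≤ 2 ^ suc g) where

  private
    w D : ℕ
    w = h + h
    D = suc j

    1≤w : 1 ≤ w
    1≤w = ≤-trans 1≤h (m≤m+n h h)

    s : Fin n
    s = fromℕ< {0} (≤-trans (*-mono-≤ (s≤s {0} {1} z≤n) (*-mono-≤ (s≤s {0} {j} z≤n) 1≤w)) levels-fit)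

    open ≤-Reasoning

    few : 2 ^ (g * h) < q ^ h
    few = subst (_< q ^ h) (^-*-assoc 2 g h) (^-monoˡ-< h {{>-nonZero 1≤h}} 2^g<q)

    -- The blocks take at most half of the labels and the `D` levels the other half; the source is
    -- paid for by the one level in which `D` exceeds `j`.
    room : h * q + suc (j * w) ≤ n
    room = *-cancelˡ-≤ 2 (begin
      2 * (h * q + suc (j * w))    ≤⟨ *-monoʳ-≤ 2 (+-monoʳ-≤ (h * q) (+-monoˡ-≤ (j * w) 1≤w)) ⟩
      2 * (h * q + D * w)          ≡⟨ regroup h q (D * w) ⟩
      q * w + 2 * (D * w)    ≤⟨ +-mono-≤ blocks-fit levels-fit ⟩
      n + n                              ≡⟨ cong (n +_) (+-identityʳ n) ⟨
      2 * n                              ∎)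
      where
      regroup : ∀ h q x → 2 * (h * q + x) ≡ q * (h + h) + 2 * x
      regroup = solve-∀

    module C = Construction P s h q (g * h) (*-mono-≤ 1≤h (≤-trans (s≤s z≤n) 2^g<q)) few

    ℓ : Fin n → ℕ
    ℓ = proj₁ (C.stages j room)

    stage : C.Stage j ℓ
    stage = proj₂ (C.stages j room)


    -- The constant is 42 = 3 · 2 · 7: 3 from `logBound`, 2 from `D ≤ j + j`, and 7 from
    -- `Δ ≤ 7 * h`.
    slots : ∀ t → j * (g * h) ≤ t → 3 * g * (D * Δ) ≤ 42 * t
    slots t jgh≤t = begin
      3 * g * (D * Δ)              ≤⟨ *-monoʳ-≤ (3 * g) (*-mono-≤ (+-monoˡ-≤ j 1≤j) Δ≤7h) ⟩
      3 * g * ((j + j) * (7 * h))  ≡⟨ regroup g j h ⟩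
      42 * (j * (g * h))           ≤⟨ *-monoʳ-≤ 42 jgh≤t ⟩
      42 * t                       ∎
      where
      regroup : ∀ g j h → 3 * g * ((j + j) * (7 * h)) ≡ 42 * (j * (g * h))
      regroup = solve-∀

  hardNetwork : ∃[ G ] ∃[ s ]
    (IsMaxEccentricity {n} G (suc j) ×
    ((v : Fin n) → Digraph.inDegree G v ≤ Δ) ×
    ((t : ℕ) → CompletesWithin P G s t →
    suc j * Δ ·log₂[ n / Δ ]≤ 42 * t))
  hardNetwork = layered ℓ , s ,
    maxEccentricity inhabited onlySource sourceLevel bounded ,
    (λ v → ≤-trans (C.inDegree-≤ stage v) 2h≤Δ) ,
    λ t complete → ·log₂-bound (3 * g) (logBound q g 1≤g 2h≤Δ blocks-max q≤2^1+g)
                     (slots t (C.completion-≥ stage complete))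
    where open C.Stage stage

-- Knowledge of `n` and `Δ` is modelled by letting the protocol be a family indexed by both.
theorem4p2 : ∃[ c ] (0 < c ×
    ((P : ℕ → ℕ → Protocol) (n D Δ : ℕ) →
    2 ≤ D → 2 ≤ Δ → 6 * D ≤ n → Δ * D ≤ n →
    ∃[ G ] ∃[ s ]
    (IsMaxEccentricity {n} G D ×
    ((v : Fin n) → Digraph.inDegree G v ≤ Δ) ×
    ((t : ℕ) → CompletesWithin (P n Δ) G s t →
    D * Δ ·log₂[ n / Δ ]≤ c * t))))
theorem4p2 = 42 , s≤s z≤n , λ where
  P n (suc j) Δ (s≤s 1≤j) 2≤Δ 6D≤n ΔD≤n →
    let h , 1≤h , 2h≤Δ , Δ≤7h , levels-fit = levelWidth n (suc j) Δ 2≤Δ 6D≤n ΔD≤n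
        q , 3≤q , blocks-fit , blocks-max =
          blockSize n (suc j) (h + h) (s≤s 1≤j) (≤-trans 1≤h (m≤m+n h h)) levels-fit
        g , 1≤g , 2^g<q , q≤2^1+g = powerBelow q 3≤q
    in hardNetwork {h = h} {q} {g} (P n Δ) 1≤j 1≤h 1≤g 2h≤Δ Δ≤7h
         levels-fit blocks-fit blocks-max 2^g<q q≤2^1+g
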